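{- For every non-empty context $\Gamma$ and formula $A$: if the sequent $\Gamma\vdash A$ is derivable in the sequent calculus, then $\varphi(\Gamma)\le A$ in the Tamari order.
   Context: Formulas are built from atoms ($p,q,\dots$) by a binary product: every formula is an atom or $A\bullet B$ for formulas $A,B$. A context is a finite (possibly empty) list of formulas; commas denote concatenation. A sequent $\Gamma\vdash A$ is a context with a formula. The sequent calculus has exactly four rules (no weakening, contraction or exchange): ($\bullet L$) from $A,B,\Delta\vdash C$ infer $A\bullet B,\Delta\vdash C$ (the product must be the leftmost formula); ($\bullet R$) from $\Gamma\vdash A$ and $\Delta\vdash B$ infer $\Gamma,\Delta\vdash A\bullet B$; ($id$) $A\vdash A$; ($cut$) from $\Theta\vdash A$ and $\Gamma,A,\Delta\vdash B$ infer $\Gamma,\Theta,\Delta\vdash B$. A sequent is derivable if it is the conclusion of a finite derivation tree built from these rules with no undischarged premises. The Tamari order $\le$ on formulas is the least preorder such that $(A\bullet B)\bullet C\le A\bullet(B\bullet C)$ for all $A,B,C$, and $A_1\le A_2$, $B_1\le B_2$ imply $A_1\bullet B_1\le A_2\bullet B_2$. For a non-empty context, $\varphi$ is its left-associated product: $\varphi(A)=A$ and $\varphi(\Gamma,A)=\varphi(\Gamma)\bullet A$; so $\varphi(A_0,A_1,\dots,A_n)=(\cdots(A_0\bullet A_1)\bullet\cdots)\bullet A_n$. -}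

module Defs where

open import Level using (Level)
open import Data.List.Base using (List; []; _∷_; [_]; _++_)
open import Data.List.NonEmpty.Base using (List⁺; foldl₁; _⁺∷ʳ_) renaming (_∷_ to _∷⁺_; [_] to [_]⁺)
open import Data.List.Properties using (foldl-∷ʳ)
open import Relation.Binary.PropositionalEquality using (_≡_; refl)

infixr 7 _•_
infix 4 _⊢_ _≤_

-- The set of atoms is an arbitrary parameter.
data Formula {a : Level} (Atom : Set a) : Set a where
  atom : Atom → Formula Atom
  _•_  : Formula Atom → Formula Atom → Formula Atom

Context : {a : Level} (Atom : Set a) → Set a
Context Atom = List (Formula Atom)

-- Γ ⊢ A is the type of closed derivations of the sequent, so that
-- derivability is inhabitation.
data _⊢_ {a : Level} {Atom : Set a} : Context Atom → Formula Atom → Set a where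
  •L  : ∀ {A B C Δ} → A ∷ B ∷ Δ ⊢ C → A • B ∷ Δ ⊢ C
  •R  : ∀ {Γ Δ A B} → Γ ⊢ A → Δ ⊢ B → Γ ++ Δ ⊢ A • B
  id  : ∀ {A} → [ A ] ⊢ A
  cut : ∀ {Θ Γ Δ A B} → Θ ⊢ A → Γ ++ A ∷ Δ ⊢ B → Γ ++ Θ ++ Δ ⊢ B

-- The Tamari order, as the inductively generated least preorder.
data _≤_ {a : Level} {Atom : Set a} : Formula Atom → Formula Atom → Set a where
  ≤-refl  : ∀ {A} → A ≤ A
  ≤-trans : ∀ {A B C} → A ≤ B → B ≤ C → A ≤ C
  ≤-assoc : ∀ {A B C} → (A • B) • C ≤ A • (B • C)
  •-mono  : ∀ {A₁ A₂ B₁ B₂} → A₁ ≤ A₂ → B₁ ≤ B₂ → A₁ • B₁ ≤ A₂ • B₂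

φ : {a : Level} {Atom : Set a} → List⁺ (Formula Atom) → Formula Atom
φ = foldl₁ _•_

-- The two recursive equations characterising φ.
φ-[] : {a : Level} {Atom : Set a} (A : Formula Atom) → φ [ A ]⁺ ≡ A
φ-[] A = refl

φ-∷ʳ : {a : Level} {Atom : Set a} (Γ : List⁺ (Formula Atom)) (A : Formula Atom) →
       φ (Γ ⁺∷ʳ A) ≡ φ Γ • A
φ-∷ʳ (B ∷⁺ Γ) A = foldl-∷ʳ _•_ B A Γ

{-# OPTIONS --safe #-}
-- Soundness holds rule by rule. The only rules that need reassociation are •R
-- and cut under a non-empty prefix: there the semi-associative law lets a
-- left-associated product move its initial factor outside, as
-- (⋯((X • A₀) • A₁) ⋯) • Aₙ ≤ X • φ(A₀, …, Aₙ).
module Submission where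

open import Defs
open import Level using (Level)
open import Data.Empty.Polymorphic using (⊥)
open import Data.List.Base using ([]; _∷_; _++_; foldl)
open import Data.List.NonEmpty.Base using (List⁺; toList) renaming (_∷_ to _∷⁺_)
open import Data.List.Properties using (foldl-++)

private
  variable
    a : Level
    Atom : Set a
    A B : Formula Atom

foldl-•-monoˡ : (Γ : Context Atom) → A ≤ B → foldl _•_ A Γ ≤ foldl _•_ B Γ
foldl-•-monoˡ []      A≤B = A≤B
foldl-•-monoˡ (C ∷ Γ) A≤B = foldl-•-monoˡ Γ (•-mono A≤B ≤-refl)

foldl-•-assoc : (X A : Formula Atom) (Γ : Context Atom) →
                foldl _•_ X (A ∷ Γ) ≤ X • foldl _•_ A Γ
foldl-•-assoc X A []      = ≤-refl
foldl-•-assoc X A (B ∷ Γ) =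
  -- Reassociating the innermost `(X • A) • B` makes `A • B` the new head, so the induction varies
  -- `A`.
  ≤-trans (foldl-•-monoˡ Γ ≤-assoc) (foldl-•-assoc X (A • B) Γ)

-- φ is undefined on the empty context, which proves nothing; including this
-- case lets the induction run over arbitrary derivations.
Valid : {Atom : Set a} → Context Atom → Formula Atom → Set a
Valid []      A = ⊥
Valid (B ∷ Γ) A = foldl _•_ B Γ ≤ A

Valid-•R : (Γ Δ : Context Atom) → Valid Γ A → Valid Δ B → Valid (Γ ++ Δ) (A • B)
-- If `Γ` or `Δ` is empty, a premise is `⊥`, so only this clause remains.
Valid-•R (C ∷ Γ) (D ∷ Δ) Γ≤A Δ≤B rewrite foldl-++ _•_ C Γ (D ∷ Δ) =
  ≤-trans (foldl-•-assoc (foldl _•_ C Γ) D Δ) (•-mono Γ≤A Δ≤B)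

Valid-cut : (Θ Γ Δ : Context Atom) → Valid Θ A → Valid (Γ ++ A ∷ Δ) B →
            Valid (Γ ++ Θ ++ Δ) B
Valid-cut (D ∷ Θ) [] Δ Θ≤A Δ≤B rewrite foldl-++ _•_ D Θ Δ =
  ≤-trans (foldl-•-monoˡ Δ Θ≤A) Δ≤B
Valid-cut {A = A} (D ∷ Θ) (C ∷ Γ) Δ Θ≤A Δ≤B
  rewrite foldl-++ _•_ C Γ (A ∷ Δ)
        | foldl-++ _•_ C Γ (D ∷ Θ ++ Δ)
        | foldl-++ _•_ (foldl _•_ C Γ • D) Θ Δ =
  -- The block `D ∷ Θ` is gathered to the right of the prefix product and bounded by `A`;
  -- monotonicity carries this through `Δ`.
  ≤-trans
    (foldl-•-monoˡ Δ
      (≤-trans (foldl-•-assoc (foldl _•_ C Γ) D Θ) (•-mono ≤-refl Θ≤A)))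
    Δ≤B

sound : {Γ : Context Atom} → Γ ⊢ A → Valid Γ A
-- As the product is leftmost, both contexts fold to the same formula by computation.
sound (•L d) = sound d
sound (•R {Γ} {Δ} d e) = Valid-•R Γ Δ (sound d) (sound e)
sound id = ≤-refl
sound (cut {Θ} {Γ} {Δ} d e) = Valid-cut Θ Γ Δ (sound d) (sound e)

theorem1p6 : {a : Level} {Atom : Set a} (Γ : List⁺ (Formula Atom)) (A : Formula Atom) →
    toList Γ ⊢ A → φ Γ ≤ A
theorem1p6 (B ∷⁺ Γ) A d = sound d
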